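{- Let $G$ be a finite simple graph and let $f$ be a demand function for the line graph $L(G)$ such that each $e\in V(L(G))$ with $e=uv\in E(G)$ satisfies $f(e)\leq 1/(\max\{d(u),d(v)\}+1)$. Then $L(G)$ has an $f$-coloring.
   Context: The line graph $L(G)$ has vertex set $E(G)$, two edges being adjacent if they share an endpoint. A fractional coloring of a graph assigns to each vertex a Lebesgue-measurable subset of $[0,1]$, adjacent vertices receiving disjoint sets; a demand function is a function $f$ from the vertex set to $[0,1]\cap\mathbb{Q}$; an $f$-coloring is a fractional coloring $\phi$ with $\mu(\phi(x))\geq f(x)$ for every vertex $x$. -}

module Defs where

open import Data.Nat using (ℕ; suc; _⊔_)
open import Data.Fin using (Fin; _<_)
open import Data.Fin.Subset using (Subset; _∈_; _∉_; ∣_∣; _∩_; ⊥)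
open import Data.Integer using (+_)
open import Data.Rational using (ℚ; _/_; 0ℚ; 1ℚ) renaming (_≤_ to _≤ℚ_)
open import Data.Product using (_×_; Σ)
open import Data.Sum using (_⊎_)
open import Relation.Binary.PropositionalEquality using (_≡_)
open import Relation.Nullary using (¬_)

record SimpleGraph (n : ℕ) : Set where
  field
    adj   : Fin n → Subset n
    sym   : ∀ {u v} → v ∈ adj u → u ∈ adj v
    irrefl : ∀ u → u ∉ adj u

module _ {n : ℕ} (G : SimpleGraph n) where
  open SimpleGraph G

  deg : Fin n → ℕ
  deg u = ∣ adj u ∣

  -- An edge uv of G, stored with u < v (so each edge appears once).
  -- These are the vertices of the line graph L(G).
  record Edge : Set where
    constructor edge
    field
      u   : Fin n
      v   : Fin n
      u<v : u < v
      uv  : v ∈ adj u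

  open Edge public

  LineAdj : Edge → Edge → Set
  LineAdj e e' =
    ¬ (u e ≡ u e' × v e ≡ v e') ×
    (u e ≡ u e' ⊎ u e ≡ v e' ⊎ v e ≡ u e' ⊎ v e ≡ v e')

  IsDemand : (Edge → ℚ) → Set
  IsDemand f = ∀ e → (0ℚ ≤ℚ f e) × (f e ≤ℚ 1ℚ)

  -- An f-coloring of L(G) (discretised: [0,1] split into N+1 equal
  -- colour slots; each vertex gets a set of slots of total measure ≥ f).
  HasFColoring : (Edge → ℚ) → Set
  HasFColoring f =
    Σ ℕ λ M → Σ (Edge → Subset (suc M)) λ φ →
      (∀ e e' → LineAdj e e' → φ e ∩ φ e' ≡ ⊥) ×
      (∀ e → f e ≤ℚ (+ ∣ φ e ∣) / suc M)

{-# OPTIONS --safe #-}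

-- Take N to be a common multiple of 1, …, n + 1 and give the edge xy the integral weight
-- w(xy) = N / (max(d(x), d(y)) + 1).  The weights at x, together with a second copy of any one
-- of them, sum to at most d(x) N / (d(x) + 1) + N / (d(x) + 1) = N, so Ore's form of Vizing's
-- theorem for multigraphs (χ' ≤ max (d(x) + μ(x))) colours the multigraph with edge
-- multiplicities w by N colours.
--
-- A colour class is a matching, represented by an involution m a of the vertices whose fixed
-- points are the vertices missing the colour a; properness then needs no hypothesis.  Let xy₀
-- have too few colours and let R be the set of vertices reached from y₀ by the fan steps
-- y ↦ m a x, a missing at y.  If x and some y in R miss the same colour, shift colours along
-- the fan.  If x misses α and two vertices of R miss β, one of them is outside the
-- α/β-component of x, and exchanging α and β outside that component leads to the first case.
-- Otherwise the sets of colours missing on R are disjoint and all appear on edges from x to R,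
-- while every y in R misses at least w(xy) colours: too many, since xy₀ has fewer than w(xy₀).

module Submission where

open import Defs
open import Data.Bool using (Bool; true; false; if_then_else_)
open import Data.Empty using (⊥; ⊥-elim)
open import Data.Fin using (Fin; zero; suc)
import Data.Fin as Fin
open import Data.Fin.Permutation using (transpose; _⟨$⟩ʳ_)
open import Data.Fin.Properties using (_≟_; any?; punchInᵢ≢i)
import Data.Fin.Properties as Fin
open import Data.Fin.Subset using (Subset; _∈_; _∉_; _∪_; _∩_; ⁅_⁆; _⊃_; ∣_∣; inside; outside) renaming (⊥ to ∅)
open import Data.Fin.Subset.Induction using (⊃-wellFounded)
open import Data.Fin.Subset.Properties using (_∈?_; x∈⁅x⁆; x∈⁅y⁆⇒x≡y; x∈p∪q⁻; x∈p∩q⁻; p⊆p∪q; q⊆p∪q; ∣p∣≤n; Empty-unique)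
open import Data.Integer using (+_)
import Data.Integer as ℤ
import Data.Integer.Properties as ℤ
open import Data.List using (List; []; _∷_)
open import Data.List.Relation.Unary.All using (All; []; _∷_)
open import Data.List.Relation.Unary.All.Properties using (¬Any⇒All¬)
open import Data.List.Relation.Unary.Any as Any using (Any; here; there)
open import Data.Nat using (ℕ; zero; suc; pred; _⊔_; _+_; _*_; _!; _≤_; _<_; _<?_; z≤n; s≤s)
import Data.Nat.DivMod as ℕ
open import Data.Nat.Divisibility using (_∣_; ∣-trans; m∣m*n; m≤n⇒m!∣n!)
open import Data.Nat.Induction using (<-wellFounded)
open import Data.Nat.Properties hiding (_≟_)
open import Algebra.Properties.CommutativeMonoid.Sum +-0-commutativeMonoid
open import Data.Nat.Tactic.RingSolver using (solve-∀)
open import Data.Product using (∃; ∃-syntax; _×_; _,_; proj₁; proj₂)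
open import Data.Rational using (ℚ; _/_) renaming (_≤_ to _≤ℚ_)
import Data.Rational.Properties as ℚ
open import Data.Rational.Unnormalised using (mkℚᵘ; *≡*)
open import Data.Sum using (_⊎_; inj₁; inj₂)
open import Data.Vec using (lookup; tabulate; []; _∷_)
open import Data.Vec.Functional using (updateAt; removeAt)
open import Data.Vec.Functional.Properties using (updateAt-updates; updateAt-minimal)
open import Data.Vec.Properties using ([]=⇒lookup; lookup⇒[]=; lookup∘tabulate)
open import Function using (_∘_; const)
open import Induction.WellFounded using (Acc; acc)
open import Relation.Binary.Construct.Closure.ReflexiveTransitive using (Star; ε; _◅_; _◅◅_)
open import Relation.Binary.PropositionalEquality
open import Relation.Nullary using (¬_; Dec; yes; no; does; contradiction)
open import Relation.Nullary.Decidable using (_×-dec_; _⊎-dec_; ¬?)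

private
  variable
    n N : ℕ
    P Q : Set

-- Indicators and finite sums

𝟙 : Dec P → ℕ
𝟙 d = if does d then 1 else 0

𝟙-yes : (d : Dec P) → P → 𝟙 d ≡ 1
𝟙-yes (yes _) _ = refl
𝟙-yes (no ¬p) p = contradiction p ¬p

𝟙-no : (d : Dec P) → ¬ P → 𝟙 d ≡ 0
𝟙-no (yes p) ¬p = contradiction p ¬p
𝟙-no (no _)  _  = refl

𝟙≤1 : (d : Dec P) → 𝟙 d ≤ 1
𝟙≤1 (yes _) = ≤-refl
𝟙≤1 (no _)  = z≤n

𝟙-mono : (d : Dec P) (d′ : Dec Q) → (P → Q) → 𝟙 d ≤ 𝟙 d′
𝟙-mono (yes p) d′ f = ≤-reflexive (sym (𝟙-yes d′ (f p)))
𝟙-mono (no _)  d′ f = z≤n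

𝟙>0⇒ : (d : Dec P) → 0 < 𝟙 d → P
𝟙>0⇒ (yes p) _ = p

sum-mono : {f g : Fin n → ℕ} → (∀ i → f i ≤ g i) → sum f ≤ sum g
sum-mono {zero}  f≤g = z≤n
sum-mono {suc n} f≤g = +-mono-≤ (f≤g zero) (sum-mono (f≤g ∘ suc))

sum-mono-< : {f g : Fin n → ℕ} → (∀ i → f i ≤ g i) → ∀ j → f j < g j → sum f < sum g
sum-mono-< f≤g zero    lt = +-mono-<-≤ lt (sum-mono (f≤g ∘ suc))
sum-mono-< f≤g (suc j) lt = +-mono-≤-< (f≤g zero) (sum-mono-< (f≤g ∘ suc) j lt)

-- Stated as a balance of two sums, which avoids truncated subtraction; this form is kept when a
-- single colour class is replaced.
sum-update : {f g : Fin n → ℕ} → ∀ j → (∀ i → i ≢ j → f i ≡ g i) →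
             sum f + g j ≡ sum g + f j
sum-update {suc n} {f} {g} j f≗g = begin
  sum f + g j                       ≡⟨ cong (_+ g j) (sum-remove {i = j} f) ⟩
  f j + sum (removeAt f j) + g j    ≡⟨ cong (λ t → f j + t + g j) (sum-cong-≗ λ i → f≗g _ (punchInᵢ≢i j i)) ⟩
  f j + sum (removeAt g j) + g j    ≡⟨ lemma (f j) (sum (removeAt g j)) (g j) ⟩
  g j + sum (removeAt g j) + f j    ≡⟨ cong (_+ f j) (sum-remove {i = j} g) ⟨
  sum g + f j                       ∎
  where
  open ≡-Reasoning
  lemma : ∀ a b c → a + b + c ≡ c + b + a
  lemma = solve-∀

sum-single : {f : Fin n → ℕ} → ∀ j → (∀ i → i ≢ j → f i ≡ 0) → sum f ≡ f j
sum-single {n} {f} j f≡0 = begin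
  sum f                     ≡⟨ +-identityʳ _ ⟨
  sum f + 0                 ≡⟨ sum-update j f≡0 ⟩
  sum {n} (const 0) + f j   ≡⟨ cong (_+ f j) (sum-replicate-zero n) ⟩
  f j                       ∎
  where open ≡-Reasoning

sum-point : (j : Fin n) → ∑[ i < n ] 𝟙 (i ≟ j) ≡ 1
sum-point j = trans (sum-single j λ i → 𝟙-no (i ≟ j)) (𝟙-yes (j ≟ j) refl)

term≤sum : (f : Fin n → ℕ) → ∀ j → f j ≤ sum f
term≤sum f zero    = m≤m+n _ _
term≤sum f (suc j) = ≤-trans (term≤sum (f ∘ suc) j) (m≤n+m _ _)

sum>0⇒∃ : (f : Fin n → ℕ) → 0 < sum f → ∃ λ i → 0 < f i
sum>0⇒∃ {suc n} f lt with f zero in eq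
... | suc _ = zero , subst (0 <_) (sym eq) (s≤s z≤n)
... | zero with i , p ← sum>0⇒∃ (f ∘ suc) lt = suc i , p

sum-zero : {f : Fin n → ℕ} → (∀ i → f i ≡ 0) → sum f ≡ 0
sum-zero {zero}  f≡0 = refl
sum-zero {suc n} f≡0 = cong₂ _+_ (f≡0 zero) (sum-zero (f≡0 ∘ suc))

sum-one : ∀ n → sum {n} (const 1) ≡ n
sum-one zero    = refl
sum-one (suc n) = cong suc (sum-one n)

-- Reachability on finite sets

record Reachable (_⟶_ : Fin n → Fin n → Set) (s : Fin n) : Set where
  field
    R      : Subset n
    start  : s ∈ R
    closed : ∀ {y z} → y ∈ R → y ⟶ z → z ∈ R
    sound  : ∀ {y} → y ∈ R → Star _⟶_ s y

-- Saturation: while some step leaves the current set, its target is added, and strict growth of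
-- subsets of a finite set must stop. `sound` keeps actual paths, from which fans are later
-- extracted.
reachable : (_⟶_ : Fin n → Fin n → Set) → (∀ y z → Dec (y ⟶ z)) → ∀ s → Reachable _⟶_ s
reachable _⟶_ _⟶?_ s =
  go ⁅ s ⁆ (⊃-wellFounded _) (x∈⁅x⁆ s) λ y∈ → subst (Star _⟶_ s) (sym (x∈⁅y⁆⇒x≡y s y∈)) ε
  where
  go : ∀ R → Acc _⊃_ R → s ∈ R → (∀ {y} → y ∈ R → Star _⟶_ s y) → Reachable _⟶_ s
  go R (acc rs) s∈R R⇒⟶* with any? (λ z → ¬? (z ∈? R) ×-dec any? (λ y → (y ∈? R) ×-dec (y ⟶? z)))
  ... | yes (z , z∉R , y , y∈R , y⟶z) =
    go (R ∪ ⁅ z ⁆) (rs (p⊆p∪q ⁅ z ⁆ , z , q⊆p∪q R ⁅ z ⁆ (x∈⁅x⁆ z) , z∉R)) (p⊆p∪q ⁅ z ⁆ s∈R) sound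
    where
    sound : ∀ {t} → t ∈ R ∪ ⁅ z ⁆ → Star _⟶_ s t
    sound t∈ with x∈p∪q⁻ R ⁅ z ⁆ t∈
    ... | inj₁ t∈R = R⇒⟶* t∈R
    ... | inj₂ t∈z rewrite x∈⁅y⁆⇒x≡y z t∈z = R⇒⟶* y∈R ◅◅ (y⟶z ◅ ε)
  ... | no ¬new = record { R = R ; start = s∈R ; closed = closed ; sound = R⇒⟶* }
    where
    closed : ∀ {y z} → y ∈ R → y ⟶ z → z ∈ R
    closed {y} {z} y∈R y⟶z with z ∈? R
    ... | yes z∈R = z∈R
    ... | no  z∉R = contradiction (z , z∉R , y , y∈R , y⟶z) ¬new

-- Alternating paths of two involutions

iter : {A : Set} → (A → A) → ℕ → A → A
iter f zero    z = z
iter f (suc k) z = f (iter f k z)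

module _ {A : Set} (f : A → A) where

  iter-+ : ∀ j k z → iter f (j + k) z ≡ iter f j (iter f k z)
  iter-+ zero    k z = refl
  iter-+ (suc j) k z = cong f (iter-+ j k z)

  iter-period : ∀ {k z} → iter f k z ≡ z → ∀ j → iter f (j * k) z ≡ z
  iter-period         fix zero    = refl
  iter-period {k} {z} fix (suc j) = begin
    iter f (k + j * k) z          ≡⟨ iter-+ k (j * k) z ⟩
    iter f k (iter f (j * k) z)   ≡⟨ cong (iter f k) (iter-period fix j) ⟩
    iter f k z                    ≡⟨ fix ⟩
    z                             ∎
    where open ≡-Reasoning

module Alternating {A : Set} (p q : A → A) (p-inv : ∀ z → p (p z) ≡ z) (q-inv : ∀ z → q (q z) ≡ z)
                   {x : A} (px≡x : p x ≡ x) where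

  private
    π : A → A
    π = p ∘ q

    iter-suc : ∀ i z → iter π (suc i) z ≡ iter π i (π z)
    iter-suc i z = trans (cong (λ k → iter π k z) (+-comm 1 i)) (iter-+ π i 1 z)

    -- Conjugation by `p` turns `π = p ∘ q` into its inverse `q ∘ p`, so the two powers of `π`
    -- cancel.
    mirror : ∀ i z → iter π i (p (iter π i z)) ≡ p z
    mirror zero    z = refl
    mirror (suc i) z = begin
      π (iter π i (p (iter π (suc i) z)))   ≡⟨ cong (λ t → π (iter π i (p t))) (iter-suc i z) ⟩
      π (iter π i (p (iter π i (π z))))     ≡⟨ cong π (mirror i (π z)) ⟩
      p (q (p (p (q z))))                   ≡⟨ cong (p ∘ q) (p-inv (q z)) ⟩
      p (q (q z))                           ≡⟨ cong p (q-inv z) ⟩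
      p z                                   ∎
      where open ≡-Reasoning

    -- If `q` fixes `iter π i x`, the walk has reached the far end of its path and turns back: the
    -- next point is the `p`-image of the current one, and `mirror` brings the walk home to `p x`,
    -- which is `x`.
    odd-period : ∀ i → q (iter π i x) ≡ iter π i x → iter π (suc (i + i)) x ≡ x
    odd-period i fix = begin
      iter π (suc i + i) x                  ≡⟨ iter-+ π (suc i) i x ⟩
      iter π (suc i) (iter π i x)           ≡⟨ cong (iter π (suc i)) (trans (sym fix) (sym (p-inv _))) ⟩
      iter π (suc i) (p (iter π (suc i) x)) ≡⟨ mirror (suc i) x ⟩
      p x                                   ≡⟨ px≡x ⟩
      x                                     ∎
      where open ≡-Reasoning

    -- 2i+1 and 2(i+e)+1 are periods of x, hence so are 2e and e(2i+1) = e + i(2e), hence so is e.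
    fixed-unique-≤ : ∀ i e → q (iter π i x) ≡ iter π i x →
                     q (iter π (i + e) x) ≡ iter π (i + e) x → iter π (i + e) x ≡ iter π i x
    fixed-unique-≤ i e fixᵢ fixⱼ = begin
      iter π (i + e) x        ≡⟨ iter-+ π i e x ⟩
      iter π i (iter π e x)   ≡⟨ cong (iter π i) period-e ⟩
      iter π i x              ∎
      where
      open ≡-Reasoning
      arith₁ : ∀ e i → e + e + suc (i + i) ≡ suc ((i + e) + (i + e))
      arith₁ = solve-∀
      arith₂ : ∀ e i → e + i * (e + e) ≡ e * suc (i + i)
      arith₂ = solve-∀
      period-2e : iter π (e + e) x ≡ x
      period-2e = begin
        iter π (e + e) x                           ≡⟨ cong (iter π (e + e)) (odd-period i fixᵢ) ⟨
        iter π (e + e) (iter π (suc (i + i)) x)    ≡⟨ iter-+ π (e + e) (suc (i + i)) x ⟨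
        iter π (e + e + suc (i + i)) x             ≡⟨ cong (λ k → iter π k x) (arith₁ e i) ⟩
        iter π (suc ((i + e) + (i + e))) x         ≡⟨ odd-period (i + e) fixⱼ ⟩
        x                                          ∎
      period-e : iter π e x ≡ x
      period-e = begin
        iter π e x                           ≡⟨ cong (iter π e) (iter-period π period-2e i) ⟨
        iter π e (iter π (i * (e + e)) x)    ≡⟨ iter-+ π e (i * (e + e)) x ⟨
        iter π (e + i * (e + e)) x           ≡⟨ cong (λ k → iter π k x) (arith₂ e i) ⟩
        iter π (e * suc (i + i)) x           ≡⟨ iter-period π (odd-period i fixᵢ) e ⟩
        x                                    ∎

    fixed-unique : ∀ i j → q (iter π i x) ≡ iter π i x → q (iter π j x) ≡ iter π j x →
                   iter π i x ≡ iter π j x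
    fixed-unique i j fixᵢ fixⱼ with ≤-total i j
    ... | inj₁ i≤j with e , refl ← m≤n⇒∃[o]m+o≡n i≤j = sym (fixed-unique-≤ i e fixᵢ fixⱼ)
    ... | inj₂ j≤i with e , refl ← m≤n⇒∃[o]m+o≡n j≤i = fixed-unique-≤ j e fixⱼ fixᵢ

  _⟷_ : A → A → Set
  y ⟷ z = p y ≡ z ⊎ q y ≡ z

  private
    OnPath : A → Set
    OnPath z = ∃ λ i → z ≡ iter π i x ⊎ z ≡ q (iter π i x)

    -- Natural exponents suffice because `p` fixes `x`: stepping backwards from exponent zero stays
    -- at `x`.
    onPath-step : ∀ {y z} → OnPath y → y ⟷ z → OnPath z
    onPath-step (i     , inj₁ refl) (inj₂ refl) = i , inj₂ refl
    onPath-step (zero  , inj₁ refl) (inj₁ refl) = 0 , inj₁ px≡x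
    onPath-step (suc i , inj₁ refl) (inj₁ refl) = i , inj₂ (p-inv _)
    onPath-step (i     , inj₂ refl) (inj₂ refl) = i , inj₁ (q-inv _)
    onPath-step (i     , inj₂ refl) (inj₁ refl) = suc i , inj₁ refl

    onPath : ∀ {y z} → OnPath y → Star _⟷_ y z → OnPath z
    onPath oy ε        = oy
    onPath oy (s ◅ ss) = onPath (onPath-step oy s) ss

    fixed-onPath : ∀ {z} → OnPath z → q z ≡ z → ∃ λ i → z ≡ iter π i x
    fixed-onPath (i , inj₁ eq)   fix = i , eq
    fixed-onPath (i , inj₂ refl) fix = i , trans (sym fix) (q-inv _)

  -- The component of `x` is a path with one end at `x`, where `p` has no partner. This leaves at
  -- most one further end, hence at most one vertex without a `q`-partner.
  component-fixed-unique : ∀ {y z} → Star _⟷_ x y → Star _⟷_ x z → q y ≡ y → q z ≡ z → y ≡ z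
  component-fixed-unique xy xz qy qz
    with i , refl ← fixed-onPath (onPath (0 , inj₁ refl) xy) qy
       | j , refl ← fixed-onPath (onPath (0 , inj₁ refl) xz) qz = fixed-unique i j qy qz

-- Families of matchings

-- Serves both recolouring moves: adding the edge xy when x is unmatched, and shifting the colour
-- from the edge x(g x) to xy otherwise.  Only meaningful when y is unmatched.
rematch : (Fin n → Fin n) → Fin n → Fin n → Fin n → Fin n
rematch g x y v with v ≟ x | v ≟ y | v ≟ g x
... | yes _ | _     | _     = y
... | no _  | yes _ | _     = x
... | no _  | no _  | yes _ = v
... | no _  | no _  | no _  = g v

module Rematch (g : Fin n → Fin n) (g-inv : ∀ v → g (g v) ≡ v)
               {x y : Fin n} (x≢y : x ≢ y) (gy≡y : g y ≡ y) where

  g′ : Fin n → Fin n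
  g′ = rematch g x y

  at-x : g′ x ≡ y
  at-x with x ≟ x | x ≟ y | x ≟ g x
  ... | yes _  | _ | _ = refl
  ... | no x≢x | _ | _ = contradiction refl x≢x

  at-y : g′ y ≡ x
  at-y with y ≟ x | y ≟ y | y ≟ g x
  ... | yes y≡x | _      | _ = contradiction (sym y≡x) x≢y
  ... | no _    | yes _  | _ = refl
  ... | no _    | no y≢y | _ = contradiction refl y≢y

  at-gx : ∀ {v} → v ≢ x → v ≢ y → v ≡ g x → g′ v ≡ v
  at-gx {v} v≢x v≢y v≡gx with v ≟ x | v ≟ y | v ≟ g x
  ... | yes v≡x | _       | _       = contradiction v≡x v≢x
  ... | no _    | yes v≡y | _       = contradiction v≡y v≢y
  ... | no _    | no _    | yes _   = refl
  ... | no _    | no _    | no v≢gx = contradiction v≡gx v≢gx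

  elsewhere : ∀ {v} → v ≢ x → v ≢ y → v ≢ g x → g′ v ≡ g v
  elsewhere {v} v≢x v≢y v≢gx with v ≟ x | v ≟ y | v ≟ g x
  ... | yes v≡x | _       | _        = contradiction v≡x v≢x
  ... | no _    | yes v≡y | _        = contradiction v≡y v≢y
  ... | no _    | no _    | yes v≡gx = contradiction v≡gx v≢gx
  ... | no _    | no _    | no _     = refl

  -- The branches of `rematch` with the inequalities that earlier branches supply. If `g` fixes `x`,
  -- the case `is-gx` is empty.
  data Position (v : Fin n) : Set where
    is-x  : v ≡ x → Position v
    is-y  : v ≡ y → Position v
    is-gx : v ≢ x → v ≢ y → v ≡ g x → Position v
    other : v ≢ x → v ≢ y → v ≢ g x → Position v

  position : ∀ v → Position v
  position v with v ≟ x | v ≟ y | v ≟ g x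
  ... | yes v≡x | _       | _        = is-x v≡x
  ... | no _    | yes v≡y | _        = is-y v≡y
  ... | no v≢x  | no v≢y  | yes v≡gx = is-gx v≢x v≢y v≡gx
  ... | no v≢x  | no v≢y  | no v≢gx  = other v≢x v≢y v≢gx

  g-inj : ∀ {v z} → g v ≡ g z → v ≡ z
  g-inj {v} {z} eq = trans (sym (g-inv v)) (trans (cong g eq) (g-inv z))

  involutive : ∀ v → g′ (g′ v) ≡ v
  involutive v with position v
  ... | is-x refl = trans (cong g′ at-x) at-y
  ... | is-y refl = trans (cong g′ at-y) at-x
  ... | is-gx v≢x v≢y v≡gx = trans (cong g′ fix) fix
    where fix = at-gx v≢x v≢y v≡gx
  -- The set of `x`, `y` and `g x` is closed under `g`, so `g v` avoids it as well and `elsewhere`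
  -- applies a second time.
  ... | other v≢x v≢y v≢gx =
    trans (cong g′ (elsewhere v≢x v≢y v≢gx))
      (trans (elsewhere (λ gv≡x → v≢gx (trans (sym (g-inv v)) (cong g gv≡x)))
                        (λ gv≡y → v≢y (g-inj (trans gv≡y (sym gy≡y))))
                        (v≢x ∘ g-inj))
             (g-inv v))

  new-pair : ∀ {u v} → u ≢ v → g′ u ≡ v → g u ≡ v ⊎ (u ≡ x × v ≡ y) ⊎ (u ≡ y × v ≡ x)
  new-pair {u} u≢v eq with position u
  ... | is-x refl = inj₂ (inj₁ (refl , trans (sym eq) at-x))
  ... | is-y refl = inj₂ (inj₂ (refl , trans (sym eq) at-y))
  ... | is-gx u≢x u≢y u≡gx = contradiction (trans (sym (at-gx u≢x u≢y u≡gx)) eq) u≢v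
  ... | other u≢x u≢y u≢gx = inj₁ (trans (sym (elsewhere u≢x u≢y u≢gx)) eq)

unmatched : (Fin n → Fin n) → ℕ
unmatched {n} g = ∑[ v < n ] 𝟙 (g v ≟ v)

module _ (g : Fin n → Fin n) (g-inv : ∀ v → g (g v) ≡ v)
         {x y : Fin n} (x≢y : x ≢ y) (gy≡y : g y ≡ y) where

  open Rematch g g-inv x≢y gy≡y

  -- The vertex `y` gains a partner and at most `g x` loses one. Adding the indicator of `y` on one
  -- side and that of `g x` on the other makes the comparison hold vertex by vertex.
  unmatched-rematch-≤ : unmatched g′ ≤ unmatched g
  unmatched-rematch-≤ = +-cancelʳ-≤ 1 _ _ (begin
    unmatched g′ + 1                                  ≡⟨ cong (λ k → unmatched g′ + k) (sum-point y) ⟨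
    unmatched g′ + ∑[ v < n ] 𝟙 (v ≟ y)               ≡⟨ ∑-distrib-+ (λ v → 𝟙 (g′ v ≟ v)) (λ v → 𝟙 (v ≟ y)) ⟨
    ∑[ v < n ] (𝟙 (g′ v ≟ v) + 𝟙 (v ≟ y))             ≤⟨ sum-mono pointwise ⟩
    ∑[ v < n ] (𝟙 (g v ≟ v) + 𝟙 (v ≟ g x))            ≡⟨ ∑-distrib-+ (λ v → 𝟙 (g v ≟ v)) (λ v → 𝟙 (v ≟ g x)) ⟩
    unmatched g + ∑[ v < n ] 𝟙 (v ≟ g x)              ≡⟨ cong (λ k → unmatched g + k) (sum-point (g x)) ⟩
    unmatched g + 1                                   ∎)
    where
    open ≤-Reasoning
    pointwise : ∀ v → 𝟙 (g′ v ≟ v) + 𝟙 (v ≟ y) ≤ 𝟙 (g v ≟ v) + 𝟙 (v ≟ g x)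
    pointwise v with position v
    ... | is-x refl
      rewrite 𝟙-no (g′ x ≟ x) (λ eq → x≢y (trans (sym eq) at-x)) | 𝟙-no (x ≟ y) x≢y = z≤n
    ... | is-y refl
      rewrite 𝟙-no (g′ y ≟ y) (λ eq → x≢y (trans (sym at-y) eq)) | 𝟙-yes (g y ≟ y) gy≡y =
        ≤-trans (𝟙≤1 (y ≟ y)) (m≤m+n 1 _)
    ... | is-gx v≢x v≢y v≡gx
      rewrite 𝟙-no (v ≟ y) v≢y | 𝟙-yes (v ≟ g x) v≡gx | +-identityʳ (𝟙 (g′ v ≟ v)) =
        ≤-trans (𝟙≤1 (g′ v ≟ v)) (m≤n+m 1 _)
    ... | other v≢x v≢y v≢gx
      rewrite 𝟙-no (v ≟ y) v≢y | elsewhere v≢x v≢y v≢gx = +-monoʳ-≤ _ z≤n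

  unmatched-rematch-< : g x ≡ x → unmatched g′ < unmatched g
  unmatched-rematch-< gx≡x = sum-mono-< (λ v → 𝟙-mono (g′ v ≟ v) (g v ≟ v) (still v)) y strict
    where
    still : ∀ v → g′ v ≡ v → g v ≡ v
    still v eq with position v
    ... | is-x refl            = gx≡x
    ... | is-y refl            = gy≡y
    ... | is-gx v≢x _ v≡gx     = contradiction (trans v≡gx gx≡x) v≢x
    ... | other v≢x v≢y v≢gx   = trans (sym (elsewhere v≢x v≢y v≢gx)) eq
    strict : 𝟙 (g′ y ≟ y) < 𝟙 (g y ≟ y)
    strict rewrite 𝟙-no (g′ y ≟ y) (λ eq → x≢y (trans (sym at-y) eq)) | 𝟙-yes (g y ≟ y) gy≡y = ≤-refl

-- Multiplicities and the number of missing colours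

mult : (Fin N → Fin n → Fin n) → Fin n → Fin n → ℕ
mult {N} m u v = ∑[ a < N ] 𝟙 (m a u ≟ v)

-- The diagonal entry `mult m v v` counts the colours missing at `v`. For involutions this total is
-- `n * N` minus twice the number of coloured edges, and it is the measure that recolouring
-- decreases.
potential : (Fin N → Fin n → Fin n) → ℕ
potential {n = n} m = ∑[ v < n ] mult m v v

potential-colourwise : (m : Fin N → Fin n → Fin n) → potential m ≡ ∑[ a < N ] unmatched (m a)
potential-colourwise m = ∑-comm (λ v a → 𝟙 (m a v ≟ v))

_[_]≔_ : (Fin N → Fin n → Fin n) → Fin N → (Fin n → Fin n) → Fin N → Fin n → Fin n
m [ a ]≔ g = updateAt m a (const g)

module _ (m : Fin N → Fin n → Fin n) (a : Fin N) (g : Fin n → Fin n) where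

  ≔-same : (m [ a ]≔ g) a ≡ g
  ≔-same = updateAt-updates a m

  ≔-other : ∀ {b} → b ≢ a → (m [ a ]≔ g) b ≡ m b
  ≔-other b≢a = updateAt-minimal _ a m b≢a

  sum-≔ : (F : (Fin n → Fin n) → ℕ) →
          ∑[ b < N ] F ((m [ a ]≔ g) b) + F (m a) ≡ ∑[ b < N ] F (m b) + F g
  sum-≔ F = trans (sum-update a λ b b≢a → cong F (≔-other b≢a))
                  (cong (λ h → ∑[ b < N ] F (m b) + F h) ≔-same)

  potential-≔ : potential (m [ a ]≔ g) + unmatched (m a) ≡ potential m + unmatched g
  potential-≔ rewrite potential-colourwise (m [ a ]≔ g) | potential-colourwise m = sum-≔ unmatched

≤-from-balance : ∀ {a b c d} → a + b ≡ c + d → d ≤ b → a ≤ c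
≤-from-balance {a} {b} {c} {d} eq d≤b =
  +-cancelʳ-≤ b a c (≤-trans (≤-reflexive eq) (+-monoʳ-≤ c d≤b))

<-from-balance : ∀ {a b c d} → a + b ≡ c + d → d < b → a < c
<-from-balance {a} {b} {c} {d} eq d<b =
  +-cancelʳ-< b a c (≤-<-trans (≤-reflexive eq) (+-monoʳ-< c d<b))

-- Exchange of two colours

module _ (α β : Fin N) where

  transpose-left : transpose α β ⟨$⟩ʳ α ≡ β
  transpose-left with α ≟ α
  ... | yes _  = refl
  ... | no α≢α = contradiction refl α≢α

  transpose-right : transpose α β ⟨$⟩ʳ β ≡ α
  transpose-right with β ≟ α
  ... | yes β≡α = β≡α
  ... | no _ with β ≟ β
  ...   | yes _  = refl
  ...   | no β≢β = contradiction refl β≢β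

  transpose-other : ∀ {a} → a ≢ α → a ≢ β → transpose α β ⟨$⟩ʳ a ≡ a
  transpose-other {a} a≢α a≢β with a ≟ α
  ... | yes a≡α = contradiction a≡α a≢α
  ... | no _ with a ≟ β
  ...   | yes a≡β = contradiction a≡β a≢β
  ...   | no _    = refl

module Kempe (m : Fin N → Fin n → Fin n) (α β : Fin N) (C : Subset n) where

  τ : Fin N → Fin N
  τ = transpose α β ⟨$⟩ʳ_

  -- The exchange is made outside `C`, so that a vertex `x` in `C` keeps all its colours and the
  -- edges of a fan at `x` keep theirs.
  swap : Fin N → Fin n → Fin n
  swap a v = if does (v ∈? C) then m a v else m (τ a) v

  swap-∈ : ∀ {v} → v ∈ C → ∀ a → swap a v ≡ m a v
  swap-∈ {v} v∈C a with v ∈? C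
  ... | yes _  = refl
  ... | no v∉C = contradiction v∈C v∉C

  swap-∉ : ∀ {v} → v ∉ C → ∀ a → swap a v ≡ m (τ a) v
  swap-∉ {v} v∉C a with v ∈? C
  ... | yes v∈C = contradiction v∈C v∉C
  ... | no _    = refl

  other-colour : ∀ {a} → a ≢ α → a ≢ β → ∀ v → swap a v ≡ m a v
  other-colour a≢α a≢β v with v ∈? C
  ... | yes _ = refl
  ... | no _  = cong (λ b → m b v) (transpose-other α β a≢α a≢β)

  -- At each vertex the colours are at most permuted by a transposition, and `mult` sums over all
  -- colours.
  mult-swap : ∀ u v → mult swap u v ≡ mult m u v
  mult-swap u v with u ∈? C
  ... | yes _ = refl
  ... | no _  = sym (sum-permute (λ a → 𝟙 (m a u ≟ v)) (transpose α β))

  potential-swap : potential swap ≡ potential m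
  potential-swap = sum-cong-≗ λ v → mult-swap v v

  module _ (m-inv : ∀ a v → m a (m a v) ≡ v)
           (α-closed : ∀ {v} → v ∈ C → m α v ∈ C) (β-closed : ∀ {v} → v ∈ C → m β v ∈ C) where

    private
      involutive-on : ∀ a → (∀ {v} → v ∈ C → m a v ∈ C) → (∀ {v} → v ∈ C → m (τ a) v ∈ C) →
                      ∀ v → swap a (swap a v) ≡ v
      involutive-on a a-closed τa-closed v with v ∈? C
      ... | yes v∈C = trans (swap-∈ (a-closed v∈C) a) (m-inv a v)
      -- The complement of `C` is closed under the involution `m (τ a)` because `C` is, so both
      -- applications of `swap` take the same branch.
      ... | no  v∉C = trans (swap-∉ (λ τv∈C → v∉C (subst (_∈ C) (m-inv (τ a) v) (τa-closed τv∈C))) a)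
                            (m-inv (τ a) v)

    swap-involutive : ∀ a v → swap a (swap a v) ≡ v
    swap-involutive a = by-colour (a ≟ α) (a ≟ β)
      where
      by-colour : Dec (a ≡ α) → Dec (a ≡ β) → ∀ v → swap a (swap a v) ≡ v
      by-colour (yes refl) _ =
        involutive-on a α-closed (λ {v} → subst (λ b → m b v ∈ C) (sym (transpose-left α β)) ∘ β-closed)
      by-colour (no _) (yes refl) =
        involutive-on a β-closed (λ {v} → subst (λ b → m b v ∈ C) (sym (transpose-right α β)) ∘ α-closed)
      by-colour (no a≢α) (no a≢β) v =
        trans (other-colour a≢α a≢β _) (trans (cong (m a) (other-colour a≢α a≢β v)) (m-inv a v))

-- Vizing's theorem in Ore's form

-- The colour `a` can be moved from the edge xz to the edge xy; `z ≢ x` says that `a` is present at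
-- `x`.
FanStep : (Fin N → Fin n → Fin n) → Fin n → Fin n → Fin n → Set
FanStep m x y z = ∃ λ a → m a y ≡ y × m a x ≡ z × z ≢ x

fanStep? : (m : Fin N → Fin n → Fin n) → ∀ x y z → Dec (FanStep m x y z)
fanStep? m x y z = any? λ a → (m a y ≟ y) ×-dec (m a x ≟ z) ×-dec ¬? (z ≟ x)

-- Distinct vertices force distinct colours m a x ≡ z, so shifting the first colour leaves the
-- rest of the fan intact.
data Fan (m : Fin N → Fin n → Fin n) (x : Fin n) : Fin n → List (Fin n) → Set where
  stop : ∀ {y} a → m a x ≡ x → m a y ≡ y → Fan m x y []
  next : ∀ {y z zs} → FanStep m x y z → All (y ≢_) (z ∷ zs) → Fan m x z zs → Fan m x y (z ∷ zs)

module _ {m : Fin N → Fin n → Fin n} {x : Fin n} where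

  fan-from : ∀ {y z zs} → Fan m x z zs → Any (y ≡_) (z ∷ zs) → ∃ (Fan m x y)
  fan-from fan            (here refl) = _ , fan
  fan-from (next _ _ fan) (there y∈)  = fan-from fan y∈

  -- If `y` already occurs, the detour is dropped and the fan restarts at that occurrence; this
  -- keeps the vertices distinct.
  fan-cons : ∀ {y z} → FanStep m x y z → ∃ (Fan m x z) → ∃ (Fan m x y)
  fan-cons {y} {z} step (zs , fan) with Any.any? (y ≟_) (z ∷ zs)
  ... | yes y∈ = fan-from fan y∈
  ... | no  y∉ = z ∷ zs , next step (¬Any⇒All¬ _ y∉) fan

  star⇒fan : ∀ {y z a} → Star (FanStep m x) y z → m a x ≡ x → m a z ≡ z → ∃ (Fan m x y)
  star⇒fan {a = a} ε    ax az = [] , stop a ax az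
  star⇒fan (step ◅ steps) ax az = fan-cons step (star⇒fan steps ax az)

  star-≢ : ∀ {y z} → y ≢ x → Star (FanStep m x) y z → z ≢ x
  star-≢ y≢x ε                              = y≢x
  star-≢ y≢x ((_ , _ , _ , z≢x) ◅ steps) = star-≢ z≢x steps

module VizingOre {n N : ℕ} (w : Fin n → Fin n → ℕ) (w-sym : ∀ u v → w u v ≡ w v u)
                 (ore : ∀ u v → sum (w u) + w u v ≤ N) where

  -- A partial colouring: an edge may have fewer colours than its multiplicity `w u v`. The diagonal
  -- is excluded from `m≤w` since `mult` counts missing colours there.
  record Colouring : Set where
    field
      m     : Fin N → Fin n → Fin n
      m-inv : ∀ a v → m a (m a v) ≡ v
      m≤w   : ∀ u v → u ≢ v → mult m u v ≤ w u v

  open Colouring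

  mult-sym : (c : Colouring) → ∀ u v → mult (m c) u v ≡ mult (m c) v u
  mult-sym c u v = sum-cong-≗ λ a →
    ≤-antisym (𝟙-mono (m c a u ≟ v) (m c a v ≟ u) (flip a)) (𝟙-mono (m c a v ≟ u) (m c a u ≟ v) (flip a))
    where
    flip : ∀ a {y z} → m c a y ≡ z → m c a z ≡ y
    flip a {y} refl = m-inv c a y

  -- Sort the `N` colours at `u` by partner: those on edges number at most `sum (w u)`, so by `ore`
  -- at least `w u v` of them are missing.
  missing≥ : (c : Colouring) → ∀ u v → w u v ≤ mult (m c) u u
  missing≥ c u v = +-cancelˡ-≤ (sum (w u)) _ _ (begin
    sum (w u) + w u v                                       ≤⟨ ore u v ⟩
    N                                                       ≡⟨ sum-one N ⟨
    ∑[ a < N ] 1                                            ≡⟨ sum-cong-≗ (λ a → sym (one a)) ⟩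
    ∑[ a < N ] ∑[ z < n ] 𝟙 (m c a u ≟ z)                   ≡⟨ ∑-comm (λ a z → 𝟙 (m c a u ≟ z)) ⟩
    ∑[ z < n ] mult (m c) u z                               ≤⟨ sum-mono pointwise ⟩
    ∑[ z < n ] (w u z + loop z)                             ≡⟨ ∑-distrib-+ (w u) loop ⟩
    sum (w u) + sum loop                                    ≡⟨ cong (λ k → sum (w u) + k) sum-loop ⟩
    sum (w u) + mult (m c) u u                              ∎)
    where
    open ≤-Reasoning
    one : ∀ a → ∑[ z < n ] 𝟙 (m c a u ≟ z) ≡ 1
    one a = trans (sum-single (m c a u) (λ z z≢ → 𝟙-no (m c a u ≟ z) (z≢ ∘ sym)))
                  (𝟙-yes (m c a u ≟ m c a u) refl)
    -- A separate summand for the missing colours, which lets the pointwise bound hold at `z = u`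
    -- too.
    loop : Fin n → ℕ
    loop z = if does (z ≟ u) then mult (m c) u u else 0
    loop-u : loop u ≡ mult (m c) u u
    loop-u with u ≟ u
    ... | yes _  = refl
    ... | no u≢u = contradiction refl u≢u
    loop-≢ : ∀ z → z ≢ u → loop z ≡ 0
    loop-≢ z z≢u with z ≟ u
    ... | yes z≡u = contradiction z≡u z≢u
    ... | no _    = refl
    sum-loop : sum loop ≡ mult (m c) u u
    sum-loop = trans (sum-single u loop-≢) loop-u
    pointwise : ∀ z → mult (m c) u z ≤ w u z + loop z
    pointwise z with z ≟ u
    ... | yes refl = m≤n+m _ _
    ... | no z≢u   = ≤-trans (m≤w c u z (z≢u ∘ sym)) (m≤m+n _ _)

  Deficient : Colouring → Fin n → Fin n → Set
  Deficient c u v = mult (m c) u v < w u v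

  Improvable : Colouring → Set
  Improvable c = ∃ λ c′ → potential (m c′) < potential (m c)

  -- Shifting colours along a fan

  module Recolour (c : Colouring) {x y : Fin n} (x≢y : x ≢ y) (deficient : Deficient c x y)
                  (a : Fin N) (ay : m c a y ≡ y) where

    open Rematch (m c a) (m-inv c a) x≢y ay

    m′ : Fin N → Fin n → Fin n
    m′ = m c [ a ]≔ g′

    same : ∀ v → m′ a v ≡ g′ v
    same v = cong (λ h → h v) (≔-same (m c) a g′)

    others : ∀ {b} → b ≢ a → ∀ v → m′ b v ≡ m c b v
    others b≢a v = cong (λ h → h v) (≔-other (m c) a g′ b≢a)

    balance : ∀ u v → mult m′ u v + 𝟙 (m c a u ≟ v) ≡ mult (m c) u v + 𝟙 (g′ u ≟ v)
    balance u v = sum-≔ (m c) a g′ (λ h → 𝟙 (h u ≟ v))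

    recoloured : Colouring
    recoloured = record { m = m′ ; m-inv = inv ; m≤w = bound }
      where
      inv : ∀ b v → m′ b (m′ b v) ≡ v
      inv b v with b ≟ a
      ... | yes refl = trans (same _) (trans (cong g′ (same v)) (involutive v))
      ... | no b≢a   = trans (others b≢a _) (trans (cong (m c b) (others b≢a v)) (m-inv c b v))
      grows : ∀ u v → Deficient c u v → mult m′ u v ≤ w u v
      grows u v def = begin
        mult m′ u v                         ≤⟨ m≤m+n _ _ ⟩
        mult m′ u v + 𝟙 (m c a u ≟ v)       ≡⟨ balance u v ⟩
        mult (m c) u v + 𝟙 (g′ u ≟ v)       ≤⟨ +-monoʳ-≤ _ (𝟙≤1 (g′ u ≟ v)) ⟩
        mult (m c) u v + 1                  ≡⟨ +-comm _ 1 ⟩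
        suc (mult (m c) u v)                ≤⟨ def ⟩
        w u v                               ∎
        where open ≤-Reasoning
      -- Only the class of `a` changes, so a multiplicity can grow only on a pair newly matched in
      -- it. That pair is xy, where the deficiency leaves room for one more colour.
      bound : ∀ u v → u ≢ v → mult m′ u v ≤ w u v
      bound u v u≢v with g′ u ≟ v
      ... | no g′u≢v = ≤-trans
        (≤-from-balance (balance u v) (𝟙-mono (g′ u ≟ v) (m c a u ≟ v) (λ eq → contradiction eq g′u≢v)))
        (m≤w c u v u≢v)
      ... | yes g′u≡v with new-pair u≢v g′u≡v
      ...   | inj₁ old = ≤-trans
        (≤-from-balance (balance u v) (𝟙-mono (g′ u ≟ v) (m c a u ≟ v) (const old)))
        (m≤w c u v u≢v)
      ...   | inj₂ (inj₁ (refl , refl)) = grows u v deficient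
      ...   | inj₂ (inj₂ (refl , refl)) =
        grows u v (subst₂ _<_ (mult-sym c v u) (w-sym v u) deficient)

    potential-≤ : potential m′ ≤ potential (m c)
    potential-≤ = ≤-from-balance (potential-≔ (m c) a g′) (unmatched-rematch-≤ (m c a) (m-inv c a) x≢y ay)

    potential-< : m c a x ≡ x → potential m′ < potential (m c)
    potential-< ax =
      <-from-balance (potential-≔ (m c) a g′) (unmatched-rematch-< (m c a) (m-inv c a) x≢y ay ax)

    -- The edge xz gives up the colour `a` and so inherits the deficiency of xy, which lets the
    -- argument move on to the next vertex of the fan.
    deficient′ : ∀ {z} → m c a x ≡ z → z ≢ x → z ≢ y → Deficient recoloured x z
    deficient′ {z} ax z≢x z≢y = begin-strict
      mult m′ x z      <⟨ <-from-balance (balance x z) loses ⟩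
      mult (m c) x z   ≤⟨ m≤w c x z (z≢x ∘ sym) ⟩
      w x z            ∎
      where
      open ≤-Reasoning
      loses : 𝟙 (g′ x ≟ z) < 𝟙 (m c a x ≟ z)
      loses rewrite 𝟙-no (g′ x ≟ z) (λ eq → z≢y (trans (sym eq) at-x)) | 𝟙-yes (m c a x ≟ z) ax = ≤-refl

    -- The colours used by the remaining fan lead from `x` to a vertex of `zs` or are missing at
    -- `x`, whereas `a` leads to `z`. None of them is `a`, and all are unaffected.
    fan′ : ∀ {z y′ zs} → m c a x ≡ z → z ≢ x → All (z ≢_) zs → Fan (m c) x y′ zs → Fan m′ x y′ zs
    fan′ ax z≢x _ (stop b bx by′) = stop b (trans (others b≢a _) bx) (trans (others b≢a _) by′)
      where
      b≢a : b ≢ a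
      b≢a refl = z≢x (trans (sym ax) bx)
    fan′ ax z≢x (z≢z′ ∷ z≢) (next (b , by′ , bx , z′≢x) fresh fan) =
      next (b , trans (others b≢a _) by′ , trans (others b≢a _) bx , z′≢x) fresh (fan′ ax z≢x z≢ fan)
      where
      b≢a : b ≢ a
      b≢a refl = z≢z′ (trans (sym ax) bx)

  -- Each shift keeps the potential from growing and passes the deficiency on; the last colour,
  -- missing at both ends, is simply added and lowers the potential. The recursion is on the list
  -- because each shift changes the colouring that indexes the fan.
  improve-fan : ∀ zs (c : Colouring) {x y} → x ≢ y → Deficient c x y → Fan (m c) x y zs → Improvable c
  improve-fan [] c x≢y def (stop a ax ay) = recoloured , potential-< ax
    where open Recolour c x≢y def a ay
  improve-fan (z ∷ zs) c x≢y def (next (a , ay , ax , z≢x) (y≢z ∷ _) fan) =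
    let c′ , lt = improve-fan zs recoloured (z≢x ∘ sym) (deficient′ ax z≢x (y≢z ∘ sym))
                    (fan′ ax z≢x (z≢zs fan) fan)
    in c′ , <-≤-trans lt potential-≤
    where
    open Recolour c x≢y def a ay
    z≢zs : ∀ {zs} → Fan (m c) _ z zs → All (z ≢_) zs
    z≢zs (stop _ _ _)     = []
    z≢zs (next _ fresh _) = fresh

  module _ (c : Colouring) {x y₀ : Fin n} (x≢y₀ : x ≢ y₀) (deficient : Deficient c x y₀) where

    improve-common : ∀ {y a} → Star (FanStep (m c) x) y₀ y → m c a x ≡ x → m c a y ≡ y → Improvable c
    improve-common steps ax ay =
      let zs , fan = star⇒fan steps ax ay in improve-fan zs c x≢y₀ deficient fan

  -- Kempe exchange outside a component

  module _ (c : Colouring) {x y₀ : Fin n} (x≢y₀ : x ≢ y₀) (deficient : Deficient c x y₀)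
           {α β : Fin N} (αx : m c α x ≡ x) where

    module Outside (C : Subset n) (x∈C : x ∈ C)
                   (α-closed : ∀ {v} → v ∈ C → m c α v ∈ C) (β-closed : ∀ {v} → v ∈ C → m c β v ∈ C) where

      open Kempe (m c) α β C

      swapped : Colouring
      swapped = record
        { m     = swap
        ; m-inv = swap-involutive (m-inv c) α-closed β-closed
        ; m≤w   = λ u v u≢v → subst (_≤ w u v) (sym (mult-swap u v)) (m≤w c u v u≢v)
        }

      -- Walk until the first vertex outside C that misses β: up to there no step is affected.
      first-outside : ∀ {y z} → Star (FanStep (m c) x) y z → z ∉ C → m c β z ≡ z →
                      ∃ λ t → Star (FanStep swap x) y t × t ∉ C × m c β t ≡ t
      first-outside {y} ε z∉C βz = y , ε , z∉C , βz
      first-outside {y} ((a , ay , ax , t≢x) ◅ steps) z∉C βz with (m c β y ≟ y) ×-dec ¬? (y ∈? C)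
      ... | yes (βy , y∉C) = y , ε , y∉C , βy
      ... | no ¬here =
        let t , steps′ , rest = first-outside steps z∉C βz
        in t , (a , trans unchanged ay , trans (swap-∈ x∈C a) ax , t≢x) ◅ steps′ , rest
        where
        -- The colour of a fan step is present at `x`, while `α` is missing there.
        a≢α : a ≢ α
        a≢α refl = t≢x (trans (sym ax) αx)
        unchanged : swap a y ≡ m c a y
        unchanged = by-place (y ∈? C) (a ≟ β)
          where
          by-place : Dec (y ∈ C) → Dec (a ≡ β) → swap a y ≡ m c a y
          by-place (yes y∈C) _          = swap-∈ y∈C a
          by-place (no _)    (no a≢β)   = other-colour a≢α a≢β y
          by-place (no y∉C)  (yes refl) = contradiction (ay , y∉C) ¬here

      -- After the exchange the vertex `t` misses `α` instead of `β`, and `x`, lying in `C`, still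
      -- misses `α`; now they share a missing colour.
      improve-outside : ∀ {y} → Star (FanStep (m c) x) y₀ y → y ∉ C → m c β y ≡ y → Improvable c
      improve-outside steps y∉C βy =
        let t , steps′ , t∉C , βt = first-outside steps y∉C βy
            c′ , lt = improve-common swapped x≢y₀ (subst (_< w x y₀) (sym (mult-swap x y₀)) deficient)
                        steps′ (trans (swap-∈ x∈C α) αx)
                        (trans (swap-∉ t∉C α) (trans (cong (λ b → m c b t) (transpose-left α β)) βt))
        in c′ , <-≤-trans lt (≤-reflexive potential-swap)

    improve-repeated : ∀ {y z} → Star (FanStep (m c) x) y₀ y → Star (FanStep (m c) x) y₀ z → y ≢ z →
                       m c β y ≡ y → m c β z ≡ z → Improvable c
    improve-repeated {y} {z} y₀y y₀z y≢z βy βz = by-place (y ∈? R) (z ∈? R)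
      where
      -- Since `α` is missing at `x`, `m c α` takes the role of the involution fixing the end `x` of
      -- the path. At most one vertex of the component `R` then misses `β`, so `y` or `z` lies
      -- outside.
      open Alternating (m c α) (m c β) (m-inv c α) (m-inv c β) αx
      open Reachable (reachable _⟷_ (λ s t → (m c α s ≟ t) ⊎-dec (m c β s ≟ t)) x)
      open Outside R start (λ v∈ → closed v∈ (inj₁ refl)) (λ v∈ → closed v∈ (inj₂ refl))
      by-place : Dec (y ∈ R) → Dec (z ∈ R) → Improvable c
      by-place (no y∉R)  _         = improve-outside y₀y y∉R βy
      by-place (yes _)   (no z∉R)  = improve-outside y₀z z∉R βz
      by-place (yes y∈R) (yes z∈R) =
        contradiction (component-fixed-unique (sound y∈R) (sound z∈R) βy βz) y≢z

  -- Counting colours on a closed set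

  module _ (c : Colouring) {x y₀ : Fin n} (deficient : Deficient c x y₀)
           (R : Subset n) (y₀∈R : y₀ ∈ R) (x∉R : x ∉ R)
           (closed : ∀ {y a} → y ∈ R → m c a y ≡ y → m c a x ∈ R)
           (disjoint : ∀ {y z a} → y ∈ R → z ∈ R → m c a y ≡ y → m c a z ≡ z → y ≡ z) where

    private
      missing? : ∀ a y → Dec (y ∈ R × m c a y ≡ y)
      missing? a y = (y ∈? R) ×-dec (m c a y ≟ y)

      joined? : ∀ a y → Dec (y ∈ R × m c a x ≡ y)
      joined? a y = (y ∈? R) ×-dec (m c a x ≟ y)

      -- By `disjoint` a colour is missing at no more than one vertex of `R`, and if it is missing
      -- at one, `closed` puts its partner at `x` into `R`.
      missing≤joined : ∀ a → ∑[ y < n ] 𝟙 (missing? a y) ≤ ∑[ y < n ] 𝟙 (joined? a y)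
      missing≤joined a with any? (missing? a)
      ... | no none = ≤-trans (≤-reflexive (sum-zero λ y → 𝟙-no (missing? a y) λ p → none (y , p))) z≤n
      ... | yes (y , y∈R , ay) = begin
        ∑[ z < n ] 𝟙 (missing? a z)    ≡⟨ sum-single y (λ z z≢y → 𝟙-no (missing? a z)
                                             λ (z∈R , az) → z≢y (disjoint z∈R y∈R az ay)) ⟩
        𝟙 (missing? a y)               ≤⟨ 𝟙≤1 (missing? a y) ⟩
        1                              ≡⟨ 𝟙-yes (joined? a (m c a x)) (closed y∈R ay , refl) ⟨
        𝟙 (joined? a (m c a x))        ≤⟨ term≤sum (λ z → 𝟙 (joined? a z)) (m c a x) ⟩
        ∑[ z < n ] 𝟙 (joined? a z)     ∎
        where open ≤-Reasoning

      restrict : ∀ {y} (g : Fin N → Fin n) → y ∈ R →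
                 ∑[ a < N ] 𝟙 ((y ∈? R) ×-dec (g a ≟ y)) ≡ ∑[ a < N ] 𝟙 (g a ≟ y)
      restrict {y} g y∈R with y ∈? R
      ... | yes _  = refl
      ... | no y∉R = contradiction y∈R y∉R

      outside-0 : ∀ {y} (g : Fin N → Fin n) → y ∉ R → ∑[ a < N ] 𝟙 ((y ∈? R) ×-dec (g a ≟ y)) ≡ 0
      outside-0 {y} g y∉R = sum-zero λ a → 𝟙-no ((y ∈? R) ×-dec (g a ≟ y)) (y∉R ∘ proj₁)

      -- At each `y` in `R` both counts are compared with `w x y`: from above by `m≤w`, from below
      -- by `missing≥`. The deficiency of `y₀` makes the comparison strict.
      joined<missing : ∑[ y < n ] ∑[ a < N ] 𝟙 (joined? a y) < ∑[ y < n ] ∑[ a < N ] 𝟙 (missing? a y)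
      joined<missing = sum-mono-< pointwise y₀ strict
        where
        pointwise : ∀ y → ∑[ a < N ] 𝟙 (joined? a y) ≤ ∑[ a < N ] 𝟙 (missing? a y)
        pointwise y = by-place (y ∈? R)
          where
          by-place : Dec (y ∈ R) → ∑[ a < N ] 𝟙 (joined? a y) ≤ ∑[ a < N ] 𝟙 (missing? a y)
          by-place (no y∉R)  = ≤-trans (≤-reflexive (outside-0 (λ a → m c a x) y∉R)) z≤n
          by-place (yes y∈R) = begin
            ∑[ a < N ] 𝟙 (joined? a y)    ≡⟨ restrict (λ a → m c a x) y∈R ⟩
            mult (m c) x y                ≤⟨ m≤w c x y (λ { refl → x∉R y∈R }) ⟩
            w x y                         ≡⟨ w-sym x y ⟩
            w y x                         ≤⟨ missing≥ c y x ⟩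
            mult (m c) y y                ≡⟨ restrict (λ a → m c a y) y∈R ⟨
            ∑[ a < N ] 𝟙 (missing? a y)   ∎
            where open ≤-Reasoning
        strict : ∑[ a < N ] 𝟙 (joined? a y₀) < ∑[ a < N ] 𝟙 (missing? a y₀)
        strict = begin-strict
          ∑[ a < N ] 𝟙 (joined? a y₀)    ≡⟨ restrict (λ a → m c a x) y₀∈R ⟩
          mult (m c) x y₀                <⟨ deficient ⟩
          w x y₀                         ≡⟨ w-sym x y₀ ⟩
          w y₀ x                         ≤⟨ missing≥ c y₀ x ⟩
          mult (m c) y₀ y₀               ≡⟨ restrict (λ a → m c a y₀) y₀∈R ⟨
          ∑[ a < N ] 𝟙 (missing? a y₀)   ∎
          where open ≤-Reasoning

    -- Double counting: summed by vertex, missing pairs outnumber joined ones; summed by colour,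
    -- they do not.
    no-closed-disjoint-fan : ⊥
    no-closed-disjoint-fan = <-irrefl refl (begin-strict
      ∑[ y < n ] ∑[ a < N ] 𝟙 (joined? a y)    <⟨ joined<missing ⟩
      ∑[ y < n ] ∑[ a < N ] 𝟙 (missing? a y)   ≡⟨ ∑-comm (λ y a → 𝟙 (missing? a y)) ⟩
      ∑[ a < N ] ∑[ y < n ] 𝟙 (missing? a y)   ≤⟨ sum-mono missing≤joined ⟩
      ∑[ a < N ] ∑[ y < n ] 𝟙 (joined? a y)    ≡⟨ ∑-comm (λ a y → 𝟙 (joined? a y)) ⟩
      ∑[ y < n ] ∑[ a < N ] 𝟙 (joined? a y)    ∎)
      where open ≤-Reasoning

  -- Deficiency makes `w u v` positive. This supplies the colour `α` of the exchange.
  missing-colour : (c : Colouring) → ∀ {u v} → Deficient c u v → ∃ λ a → m c a u ≡ u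
  missing-colour c {u} {v} def =
    let a , p = sum>0⇒∃ (λ a → 𝟙 (m c a u ≟ u)) (<-≤-trans (≤-<-trans z≤n def) (missing≥ c u v))
    in a , 𝟙>0⇒ (m c a u ≟ u) p

  improve : (c : Colouring) → ∀ {x y} → x ≢ y → Deficient c x y → Improvable c
  improve c {x} {y₀} x≢y₀ def = by-search
    (any? λ y → any? λ a → (y ∈? R) ×-dec (m c a x ≟ x) ×-dec (m c a y ≟ y))
    (any? λ y → any? λ z → any? λ a →
      (y ∈? R) ×-dec (z ∈? R) ×-dec ¬? (y ≟ z) ×-dec (m c a y ≟ y) ×-dec (m c a z ≟ z))
    where
    open Reachable (reachable (FanStep (m c) x) (fanStep? (m c) x) y₀)

    Common Repeated : Set
    Common   = ∃[ y ] ∃[ a ] y ∈ R × m c a x ≡ x × m c a y ≡ y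
    Repeated = ∃[ y ] ∃[ z ] ∃[ a ] y ∈ R × z ∈ R × y ≢ z × m c a y ≡ y × m c a z ≡ z

    by-search : Dec Common → Dec Repeated → Improvable c
    by-search (yes (y , a , y∈R , ax , ay)) _ = improve-common c x≢y₀ def (sound y∈R) ax ay
    by-search (no _) (yes (y , z , a , y∈R , z∈R , y≢z , ay , az)) =
      improve-repeated c x≢y₀ def (proj₂ (missing-colour c def)) (sound y∈R) (sound z∈R) y≢z ay az
    by-search (no no-common) (no no-repeated) = ⊥-elim (no-closed-disjoint-fan c def R start
      (λ x∈R → star-≢ (x≢y₀ ∘ sym) (sound x∈R) refl)
      -- As no colour is missing at both `x` and `y`, the colour `a` is present at `x`, and its
      -- partner there is a fan step from `y`.
      (λ {y} {a} y∈R ay → closed y∈R (a , ay , refl , λ ax → no-common (y , a , y∈R , ax , ay)))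
      disjoint)
      where
      disjoint : ∀ {y z a} → y ∈ R → z ∈ R → m c a y ≡ y → m c a z ≡ z → y ≡ z
      disjoint {y} {z} {a} y∈R z∈R ay az with y ≟ z
      ... | yes y≡z = y≡z
      ... | no  y≢z = contradiction (y , z , a , y∈R , z∈R , y≢z , ay , az) no-repeated

  empty : Colouring
  empty = record
    { m     = λ _ v → v
    ; m-inv = λ _ _ → refl
    ; m≤w   = λ u v u≢v → ≤-trans (≤-reflexive (sum-zero {N} λ _ → 𝟙-no (u ≟ v) u≢v)) z≤n
    }

  Complete : Colouring → Set
  Complete c = ∀ u v → u ≢ v → mult (m c) u v ≡ w u v

  -- Start with every colour missing everywhere and improve until no edge is deficient; the
  -- potential bounds the number of rounds.
  complete : ∃ Complete
  complete = go empty (<-wellFounded _)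
    where
    go : ∀ c → Acc _<_ (potential (m c)) → ∃ Complete
    go c (acc rs) with any? (λ u → any? λ v → ¬? (u ≟ v) ×-dec (mult (m c) u v <? w u v))
    ... | yes (u , v , u≢v , def) = let c′ , lt = improve c u≢v def in go c′ (rs lt)
    ... | no none = c , λ u v u≢v → ≤-antisym (m≤w c u v u≢v) (≮⇒≥ λ def → none (u , v , u≢v , def))

-- Edge weights and colour sets

size-tabulate : (g : Fin n → Bool) → ∣ tabulate g ∣ ≡ ∑[ i < n ] (if g i then 1 else 0)
size-tabulate {zero}  g = refl
size-tabulate {suc n} g with g zero
... | true  = cong suc (size-tabulate (g ∘ suc))
... | false = size-tabulate (g ∘ suc)

sum-subset : (p : Subset n) (k : ℕ) → ∑[ i < n ] (if lookup p i then k else 0) ≡ ∣ p ∣ * k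
sum-subset []            k = refl
sum-subset (inside  ∷ p) k = cong (_+_ k) (sum-subset p k)
sum-subset (outside ∷ p) k = sum-subset p k

-- The multiple is `suc n !`; `pred` gives it the form `suc M` of the number of colour slots.
common-multiple : ∀ n → ∃ λ M → ∀ {d} → d ≤ n → suc d ∣ suc M
common-multiple n = pred (suc n !) , λ {d} d≤n →
  subst (suc d ∣_) (sym (suc-pred (suc n !) {{suc n !≢0}})) (∣-trans (m∣m*n (d !)) (m≤n⇒m!∣n! (s≤s d≤n)))

unit-fraction : ∀ M d k → k * suc d ≡ suc M → + 1 / suc d ≡ + k / suc M
unit-fraction M d k eq = ℚ.fromℚᵘ-cong {mkℚᵘ (+ 1) d} {mkℚᵘ (+ k) M} (*≡* (begin
  + 1 ℤ.* + suc M   ≡⟨ ℤ.*-identityˡ (+ suc M) ⟩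
  + suc M           ≡⟨ cong +_ eq ⟨
  + (k * suc d)     ≡⟨ ℤ.pos-* k (suc d) ⟩
  + k ℤ.* + suc d   ∎))
  where open ≡-Reasoning

module _ (G : SimpleGraph n) where
  open SimpleGraph G renaming (sym to adj-sym)

  adj-lookup-sym : ∀ x y → lookup (adj x) y ≡ lookup (adj y) x
  adj-lookup-sym x y with lookup (adj x) y in xy | lookup (adj y) x in yx
  ... | true  | true  = refl
  ... | false | false = refl
  ... | true  | false = trans (sym ([]=⇒lookup (adj-sym (lookup⇒[]= y (adj x) xy)))) yx
  ... | false | true  = trans (sym xy) ([]=⇒lookup (adj-sym (lookup⇒[]= x (adj y) yx)))

  module Weight (N : ℕ) where

    weight : Fin n → Fin n → ℕ
    weight x y = if lookup (adj x) y then N ℕ./ suc (deg G x ⊔ deg G y) else 0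

    weight-sym : ∀ x y → weight x y ≡ weight y x
    weight-sym x y rewrite adj-lookup-sym x y | ⊔-comm (deg G x) (deg G y) = refl

    weight-edge : (e : Edge G) → weight (u e) (v e) ≡ N ℕ./ suc (deg G (u e) ⊔ deg G (v e))
    weight-edge e rewrite []=⇒lookup (uv e) = refl

    module _ (x : Fin n) where

      private
        share : ℕ
        share = N ℕ./ suc (deg G x)

        weight≤share : ∀ y → weight x y ≤ (if lookup (adj x) y then share else 0)
        weight≤share y with lookup (adj x) y
        ... | true  = ℕ./-monoʳ-≤ N (s≤s (m≤m⊔n (deg G x) (deg G y)))
        ... | false = z≤n

        if≤share : ∀ b → (if b then share else 0) ≤ share
        if≤share true  = ≤-refl
        if≤share false = z≤n

      -- Every weight at `x` is at most `share`, as the maximum of the degrees is at least that of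
      -- `x`. With the repeated weight there are `suc (deg G x)` shares, and rounding down keeps
      -- them within `N`.
      weight-ore : ∀ y → sum (weight x) + weight x y ≤ N
      weight-ore y = begin
        sum (weight x) + weight x y   ≤⟨ +-mono-≤ (sum-mono weight≤share) (≤-trans (weight≤share y) (if≤share _)) ⟩
        ∑[ z < n ] (if lookup (adj x) z then share else 0) + share
                                      ≡⟨ cong (_+ share) (sum-subset (adj x) share) ⟩
        deg G x * share + share       ≡⟨ +-comm _ share ⟩
        suc (deg G x) * share         ≡⟨ *-comm (suc (deg G x)) share ⟩
        share * suc (deg G x)         ≤⟨ ℕ.m/n*n≤m N (suc (deg G x)) ⟩
        N                             ∎
        where open ≤-Reasoning

  module _ (m : Fin N → Fin n → Fin n) (m-inv : ∀ a x → m a (m a x) ≡ x) where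

    colours : Edge G → Subset N
    colours e = tabulate λ a → does (m a (u e) ≟ v e)

    private
      matched : ∀ {e a} → a ∈ colours e → m a (u e) ≡ v e
      matched {e} {a} a∈ = from-does (m a (u e) ≟ v e)
        (trans (sym (lookup∘tabulate (λ b → does (m b (u e) ≟ v e)) a)) ([]=⇒lookup a∈))
        where
        from-does : {P : Set} (d : Dec P) → does d ≡ true → P
        from-does (yes p) _ = p

      matched⁻ : ∀ {e a} → a ∈ colours e → m a (v e) ≡ u e
      matched⁻ {e} {a} a∈ = trans (cong (m a) (sym (matched {e} a∈))) (m-inv a (u e))

    -- A common colour sends the shared endpoint to the other end of both edges, so the edges have
    -- the same ends. If the endpoints agree in position, the edges coincide; if they are crossed,
    -- the order `u<v` is violated.
    colours-disjoint : ∀ e e′ → LineAdj G e e′ → colours e ∩ colours e′ ≡ ∅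
    colours-disjoint e e′ (e≢e′ , shared) = Empty-unique λ (a , a∈) →
      let a∈e , a∈e′ = x∈p∩q⁻ (colours e) (colours e′) a∈ in impossible a a∈e a∈e′ shared
      where
      impossible : ∀ a → a ∈ colours e → a ∈ colours e′ →
                   ¬ (u e ≡ u e′ ⊎ u e ≡ v e′ ⊎ v e ≡ u e′ ⊎ v e ≡ v e′)
      impossible a a∈e a∈e′ (inj₁ uu) =
        e≢e′ (uu , trans (sym (matched {e} a∈e)) (trans (cong (m a) uu) (matched {e′} a∈e′)))
      impossible a a∈e a∈e′ (inj₂ (inj₁ uv′)) =
        Fin.<-asym (u<v e) (subst₂ Fin._<_ (sym vu′) (sym uv′) (u<v e′))
        where
        vu′ : v e ≡ u e′
        vu′ = trans (sym (matched {e} a∈e)) (trans (cong (m a) uv′) (matched⁻ {e′} a∈e′))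
      impossible a a∈e a∈e′ (inj₂ (inj₂ (inj₁ vu′))) =
        Fin.<-asym (u<v e) (subst₂ Fin._<_ (sym vu′) (sym uv′) (u<v e′))
        where
        uv′ : u e ≡ v e′
        uv′ = trans (sym (matched⁻ {e} a∈e)) (trans (cong (m a) vu′) (matched {e′} a∈e′))
      impossible a a∈e a∈e′ (inj₂ (inj₂ (inj₂ vv))) =
        e≢e′ (trans (sym (matched⁻ {e} a∈e)) (trans (cong (m a) vv) (matched⁻ {e′} a∈e′)) , vv)

theorem6p1 : ∀ {n} (G : SimpleGraph n) (f : Edge G → ℚ) →
    IsDemand G f →
    (∀ e → f e ≤ℚ (+ 1) / suc (deg G (u e) ⊔ deg G (v e))) →
    HasFColoring G f
theorem6p1 {n} G f _ f≤ with M , divides ← common-multiple n =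
  M , colours G m m-inv , colours-disjoint G m m-inv , λ e → subst (f e ≤ℚ_) (share≡ e) (f≤ e)
  where
  open Weight G (suc M)
  open VizingOre weight weight-sym weight-ore
  open Colouring (proj₁ complete)
  u≢v : ∀ e → u e ≢ v e
  u≢v e = Fin.<⇒≢ (u<v e)
  max : Edge G → ℕ
  max e = deg G (u e) ⊔ deg G (v e)
  size : ∀ e → ∣ colours G m m-inv e ∣ ≡ suc M ℕ./ suc (max e)
  size e = begin
    ∣ colours G m m-inv e ∣      ≡⟨ size-tabulate (λ a → does (m a (u e) ≟ v e)) ⟩
    -- Since `𝟙` is defined through `does`, the sum given by `size-tabulate` is `mult` by
    -- definition.
    mult m (u e) (v e)           ≡⟨ proj₂ complete (u e) (v e) (u≢v e) ⟩
    weight (u e) (v e)           ≡⟨ weight-edge e ⟩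
    suc M ℕ./ suc (max e)        ∎
    where open ≡-Reasoning
  share≡ : ∀ e → + 1 / suc (max e) ≡ + ∣ colours G m m-inv e ∣ / suc M
  -- Degrees are sizes of subsets of `Fin n`, so `max e` is at most `n`. Hence `suc (max e)` divides
  -- `suc M`, and the rounded division in the weight is exact.
  share≡ e = unit-fraction M (max e) ∣ colours G m m-inv e ∣ (trans (cong (_* suc (max e)) (size e))
    (ℕ.m/n*n≡m (divides (⊔-lub (∣p∣≤n (SimpleGraph.adj G (u e))) (∣p∣≤n (SimpleGraph.adj G (v e)))))))
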